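{- Let $n,m\ge1$ be integers. The optimal objective value of the following integer linear program (with $\mathcal{H}_m$, $\ell(h)$ and $\lambda_i(h)$ as defined in the context) is equal to $\mathrm{OPT}^{\mathrm{det,full}}_n(m)$, the optimal worst-case success probability of deterministic policies in the adversarial-order full-history model with $m$ signals: $$\begin{aligned}\max\quad & z\\ \text{s.t.}\quad & \sum_{t=\ell(h)}^n x_{h,t}=1 && \forall h\in\mathcal{H}_m,\\ & \sum_{h\in\mathcal{H}_m:\ \ell(h)\le i}\lambda_i(h)\,x_{h,i}\ge z && \forall i\in[n],\\ & x_{h,t}\in\{0,1\} && \forall h\in\mathcal{H}_m,\ \forall t\in\{\ell(h),\dots,n\}.\end{aligned}$$
   Context: Notation: $[n]=\{1,\dots,n\}$. Adversarial-order full-history model with $m$ signals: an adversary fixes an instance, i.e. a value vector $v\in\mathbb{N}_0^n$ with a unique maximum entry, located at a time $i^\star\in[n]$. Items arrive one by one at times $1,\dots,n$ in this order. Signal times $S_1,\dots,S_m$ are drawn independently and uniformly from $[i^\star]$. At each time $t$ the policy observes $v_t$ and the number of signals occurring at time $t$ (signals are unlabeled), and then irrevocably decides whether to stop at time $t$. It knows $n$ and $m$, but not the instance; it succeeds if it stops exactly at time $i^\star$. A deterministic policy uses no internal randomness: its decision at time $t$ is a function of the observations up to time $t$. The worst-case success probability of a policy is the infimum over all instances of length $n$ of its success probability (over the signals). $\mathrm{OPT}^{\mathrm{det,full}}_n(m)$ is the supremum of the worst-case success probability over all deterministic policies. Histories: a history is a vector $h=(c_1,\dots,c_{\ell(h)},0,\dots,0)\in\{0,1,\dots,m\}^n$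 with $c_{\ell(h)}>0$ and $\sum_{t=1}^{\ell(h)}c_t=m$; here $c_t$ is the number of signals at time $t$ and $\ell(h)\in[n]$ is the time of the last signal. $\mathcal{H}_m$ is the set of all histories. For $i\in[n]$ and $h\in\mathcal{H}_m$, with $0!=1$, $$\lambda_i(h):=\begin{cases}\dfrac{m!}{c_1!\cdots c_{\ell(h)}!}\cdot\dfrac1{i^m}, & \ell(h)\le i,\\ 0, & \ell(h)>i.\end{cases}$$ -}

module Defs where

open import Data.Bool using (Bool; T; T?; if_then_else_)
open import Data.Fin using (Fin; toℕ; _≤_; _<_; _≤?_; _<?_; _≟_)
open import Data.Fin.Properties using (toℕ<n; all?)
open import Data.Integer using (+_)
open import Data.List using (List; []; _∷_; allFin; cartesianProduct; cartesianProductWith; filter; foldr; length; map; mapMaybe)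
open import Data.List.Relation.Unary.All using (universal)
open import Data.List.Relation.Unary.All.Properties using (map⁺)
open import Data.Maybe using (Maybe)
import Data.Maybe as Maybe
open import Data.Nat using (ℕ; zero; suc; NonZero; _^_; _!)
import Data.Nat as ℕ
open import Data.Nat.ListAction using (sum; product)
open import Data.Nat.ListAction.Properties using (product≢0)
open import Data.Nat.Properties using (_!≢0; m^n≢0)
open import Data.Product using (_×_; _,_; ∃-syntax)
open import Data.Rational using (ℚ; 0ℚ; 1ℚ; _/_)
import Data.Rational as ℚ
open import Data.Sum using (_⊎_)
open import Data.Vec using (Vec; []; _∷_; lookup; tabulate; count; truncate)
open import Level using (0ℓ)
open import Relation.Binary.PropositionalEquality using (_≡_; _≢_)
open import Relation.Nullary using (¬_; Dec; does)
open import Relation.Nullary.Decidable using (_×-dec_; _→-dec_; ¬?; dec⇒maybe)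
open import Relation.Unary using (Pred; _∈_)

-- Times 1, …, n are represented by Fin n, so t : Fin n is the time suc (toℕ t).

IsMaximum : Pred ℚ 0ℓ → ℚ → Set
IsMaximum A z = z ∈ A × (∀ q → q ∈ A → q ℚ.≤ z)

IsInfimum : Pred ℚ 0ℓ → ℚ → Set
IsInfimum A z =
  (∀ q → q ∈ A → z ℚ.≤ q) × (∀ u → (∀ q → q ∈ A → u ℚ.≤ q) → u ℚ.≤ z)

IsSupremum : Pred ℚ 0ℓ → ℚ → Set
IsSupremum A z =
  (∀ q → q ∈ A → q ℚ.≤ z) × (∀ u → (∀ q → q ∈ A → q ℚ.≤ u) → z ℚ.≤ u)

∑ : ∀ {A : Set} → List A → (A → ℚ) → ℚ
∑ xs f = foldr ℚ._+_ 0ℚ (map f xs)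

syntax ∑ xs (λ x → e) = ∑[ x ∈ xs ] e

upTo : ∀ {n} → Fin n → List (Fin n)
upTo i = filter (_≤? i) (allFin _)

vectors : ∀ {A : Set} → List A → (k : ℕ) → List (Vec A k)
vectors xs zero    = [] ∷ []
vectors xs (suc k) = cartesianProductWith _∷_ xs (vectors xs k)

record Instance (n : ℕ) : Set where
  field
    v         : Vec ℕ n
    i⋆        : Fin n
    uniqueMax : ∀ j → j ≢ i⋆ → lookup v j ℕ.< lookup v i⋆

-- The vector holds the pairs (value, number of signals) observed at the times
-- up to and including t; true means stop.
Policy : ℕ → Set
Policy n = (t : Fin n) → Vec (ℕ × ℕ) (suc (toℕ t)) → Bool

observations : ∀ {n m} → Vec ℕ n → Vec (Fin n) m → Vec (ℕ × ℕ) n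
observations v S = tabulate λ t → lookup v t , count (_≟ t) S

decision : ∀ {n} → Policy n → Vec (ℕ × ℕ) n → Fin n → Bool
decision π obs t = π t (truncate (toℕ<n t) obs)

StopsAt : ∀ {n} → Policy n → Vec (ℕ × ℕ) n → Fin n → Set
StopsAt π obs t =
  T (decision π obs t) × (∀ s → s < t → ¬ T (decision π obs s))

stopsAt? : ∀ {n} (π : Policy n) obs t → Dec (StopsAt π obs t)
stopsAt? π obs t =
  T? (decision π obs t) ×-dec all? λ s → (s <? t) →-dec ¬? (T? (decision π obs s))

-- Each of the i⋆ ^ m tuples of signal times is equally likely.
successProbability : ∀ {n} (m : ℕ) → Policy n → Instance n → ℚ
successProbability m π I =
  (+ length (filter (λ S → stopsAt? π (observations v S) i⋆) (vectors (upTo i⋆) m)))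
    / (suc (toℕ i⋆) ^ m)
  where
  open Instance I
  instance
    _ : NonZero (suc (toℕ i⋆) ^ m)
    _ = m^n≢0 (suc (toℕ i⋆)) m

-- For a fixed policy only finitely many success probabilities occur, so
-- classically this infimum is a rational number for every policy.
IsWorstCase : ∀ {n} (m : ℕ) → Policy n → ℚ → Set
IsWorstCase {n} m π = IsInfimum λ q → ∃[ I ] q ≡ successProbability {n} m π I

IsOPT : (n m : ℕ) → ℚ → Set
IsOPT n m = IsSupremum λ w → ∃[ π ] IsWorstCase {n} m π w

signals : ∀ {n m} → Vec (Fin (suc m)) n → Fin n → ℕ
signals c t = toℕ (lookup c t)

IsHistory : ∀ {n m} → Vec (Fin (suc m)) n → Fin n → Set
IsHistory {m = m} c ℓ =
    0 ℕ.< signals c ℓ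
  × (∀ t → ℓ < t → signals c t ≡ 0)
  × sum (map (signals c) (upTo ℓ)) ≡ m

isHistory? : ∀ {n m} (c : Vec (Fin (suc m)) n) ℓ → Dec (IsHistory c ℓ)
isHistory? {m = m} c ℓ =
       (0 ℕ.<? signals c ℓ)
  ×-dec ((all? λ t → (ℓ <? t) →-dec (signals c t ℕ.≟ 0))
  ×-dec   (sum (map (signals c) (upTo ℓ)) ℕ.≟ m))

-- Validity is irrelevant, so a history is determined by its count vector
-- (which in turn determines ℓ).
record History (n m : ℕ) : Set where
  constructor history
  field
    counts : Vec (Fin (suc m)) n
    ℓ      : Fin n
    .valid : IsHistory counts ℓ

open History public using (counts; ℓ)

histories : ∀ n m → List (History n m)
histories n m =
  mapMaybe toHistory (cartesianProduct (vectors (allFin (suc m)) n) (allFin n))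
  where
  toHistory : Vec (Fin (suc m)) n × Fin n → Maybe (History n m)
  toHistory (c , l) = Maybe.map (λ p → history c l p) (dec⇒maybe (isHistory? c l))

factorials : ∀ {n m} → History n m → ℕ
factorials h = product (map (λ t → signals (counts h) t !) (upTo (ℓ h)))

factorials≢0 : ∀ {n m} (h : History n m) → NonZero (factorials h)
factorials≢0 h =
  product≢0 (map⁺ (universal (λ t → signals (counts h) t !≢0) (upTo (ℓ h))))

lam : ∀ {n m} → Fin n → History n m → ℚ
lam {m = m} i h =
  if does (ℓ h ≤? i)
  then ((+ (m !)) / factorials h) ℚ.* ((+ 1) / (suc (toℕ i) ^ m))
  else 0ℚ
  where
  instance
    _ : NonZero (factorials h)
    _ = factorials≢0 h
    _ : NonZero (suc (toℕ i) ^ m)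
    _ = m^n≢0 (suc (toℕ i)) m

-- Only the entries x h t with ℓ h ≤ t are variables of the program; the
-- remaining entries occur in no constraint.
record Feasible (n m : ℕ) (x : History n m → Fin n → ℚ) (z : ℚ) : Set where
  field
    stopOnce : ∀ h → ∑[ t ∈ filter (ℓ h ≤?_) (allFin n) ] x h t ≡ 1ℚ
    winning  : ∀ i →
      ∑[ h ∈ filter (λ h → ℓ h ≤? i) (histories n m) ] (lam i h ℚ.* x h i) ℚ.≥ z
    binary   : ∀ h t → ℓ h ≤ t → x h t ≡ 0ℚ ⊎ x h t ≡ 1ℚ

IsILPValue : (n m : ℕ) → ℚ → Set
IsILPValue n m = IsMaximum λ z → ∃[ x ] Feasible n m x z

{-# OPTIONS --safe #-}

-- Rules τ, assigning to each history h a stopping time ≥ ℓ h, mediate between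
-- the two optima.  They are the feasible points x of the program, the left-hand
-- side of the i-th constraint being value τ i.  A rule is also a policy that
-- ignores the values, and since the number of signal tuples with history h is
-- the multinomial coefficient in lam, it succeeds with probability value τ i
-- on every instance with i⋆ = i.  Conversely, for each i let the adversary play
-- the values 1, …, i, 0, …, 0.  Up to time i these do not depend on i, so the
-- policy wins only if i is its stopping time on h with values 1, …, n; this
-- stopping time is a rule doing at least as well.  There are finitely many
-- rules, so a best one exists.

module Submission where

open import Algebra.Properties.CommutativeSemigroup using (interchange; x∙yz≈y∙xz)
open import Data.Bool using (true; false; T; if_then_else_)
open import Data.Fin using (Fin; zero; suc; toℕ; fromℕ<; inject≤; _≟_; _≤?_)
import Data.Fin as Fin
import Data.Fin.Properties as Fin
open import Data.Integer using (+_)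
import Data.Integer as ℤ
import Data.Integer.Properties as ℤ
open import Data.List using (List; []; _∷_; _++_; allFin; cartesianProduct; cartesianProductWith; filter; foldr; length; map; mapMaybe)
open import Data.List.Membership.Propositional using (_∈_; _∉_; find; lose)
open import Data.List.Membership.Propositional.Properties using (∈-∃++; ∈-allFin; ∈-cartesianProduct⁺; ∈-cartesianProductWith⁺; ∈-cartesianProductWith⁻; ∈-filter⁺; ∈-filter⁻)
open import Data.List.Properties using (filter-++; filter-none; filter-≐; length-++; map-cong; map-cong-local)
open import Data.List.Relation.Binary.Permutation.Propositional using (_↭_; ↭⇒↭ₛ)
open import Data.List.Relation.Binary.Permutation.Propositional.Properties using (map⁺; shift)
import Data.List.Relation.Binary.Permutation.Setoid.Properties as Permutationₛ
import Data.List.Relation.Unary.All as All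
open import Data.List.Relation.Unary.All using ([]; _∷_)
import Data.List.Relation.Unary.All.Properties as All
import Data.List.Relation.Unary.Any as Any
open import Data.List.Relation.Unary.Any using (here; there)
import Data.List.Relation.Unary.Any.Properties as Any
open import Data.List.Relation.Unary.Unique.Propositional using (Unique; []; _∷_)
import Data.List.Relation.Unary.Unique.Propositional.Properties as Unique
open import Data.Maybe using (Maybe; just; nothing)
import Data.Maybe as Maybe
import Data.Maybe.Relation.Unary.All as MaybeAll
import Data.Maybe.Relation.Unary.Any as MaybeAny
open import Data.Nat using (ℕ; zero; suc; NonZero; _+_; _*_; _^_; _!; _≤_; z≤n; s≤s)
import Data.Nat as ℕ
open import Data.Nat.ListAction using (sum; product)
open import Data.Nat.ListAction.Properties using (sum-↭; product-↭)
import Data.Nat.Properties as ℕ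
open import Data.Product using (_×_; _,_; ∃-syntax; proj₁; proj₂)
open import Data.Rational using (ℚ; 0ℚ; 1ℚ; NonNegative; nonNegative; _/_; fromℚᵘ; toℚᵘ)
import Data.Rational as ℚ
import Data.Rational.Properties as ℚ
open import Data.Rational.Unnormalised using (mkℚᵘ; *≡*; *≤*)
import Data.Rational.Unnormalised as ℚᵘ
import Data.Rational.Unnormalised.Properties as ℚᵘ
open import Data.Sum using (_⊎_; inj₁; inj₂)
open import Data.Vec using (Vec; []; _∷_; count; lookup; tabulate; truncate)
open import Data.Vec.Properties using (count≤n; lookup∘tabulate; lookup-truncate; tabulate∘lookup; tabulate-cong; ∷-injective; ≡-dec)
open import Defs
open import Function using (_∘_)
open import Level using (0ℓ)
open import Relation.Binary.Bundles using (DecTotalOrder)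
open import Relation.Binary.Definitions using (DecidableEquality; tri<; tri≈; tri>)
open import Relation.Binary.PropositionalEquality
open import Relation.Nullary using (¬_; Dec; yes; no; does; contradiction)
open import Relation.Nullary.Decidable using (⌊_⌋; dec⇒maybe; dec-false; dec-true; fromWitness; map′; recompute; toWitness; _×-dec_)
open import Relation.Unary using (Pred; Decidable)

private variable
  A B C : Set
  n m : ℕ

-- Counting in duplicate-free lists.

indicator : {P : Set} → Dec P → ℕ
indicator d = if does d then 1 else 0

indicator-yes : {P : Set} (d : Dec P) → P → indicator d ≡ 1
indicator-yes d p = cong (if_then 1 else 0) (dec-true d p)

indicator-no : {P : Set} (d : Dec P) → ¬ P → indicator d ≡ 0
indicator-no d ¬p = cong (if_then 1 else 0) (dec-false d ¬p)

indicator-mono : {P Q : Set} (d : Dec P) (e : Dec Q) → (P → Q) → indicator d ≤ indicator e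
indicator-mono (no _)  e f = z≤n
indicator-mono (yes p) e f = ℕ.≤-reflexive (sym (indicator-yes e (f p)))

-- A permutation bringing `x` to the front preserves uniqueness, so `x` does not recur in the rest.
-- Sums and products are invariant under it, which isolates a single term.
extract : {x : A} {xs : List A} → Unique xs → x ∈ xs → ∃[ ys ] (xs ↭ x ∷ ys × x ∉ ys)
extract {A = A} u x∈xs with ys , zs , refl ← ∈-∃++ x∈xs =
  ys ++ zs , p , Unique.Unique[x∷xs]⇒x∉xs (Permutationₛ.Unique-resp-↭ (setoid A) (↭⇒↭ₛ p) u)
  where p = shift _ ys zs

module _ {x : A} {xs : List A} (u : Unique xs) (x∈xs : x ∈ xs) where

  private
    ys  = proj₁ (extract u x∈xs)
    xs↭ = proj₁ (proj₂ (extract u x∈xs))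
    x∉  = proj₂ (proj₂ (extract u x∈xs))

    ∈ys⇒≢ : ∀ {y} → y ∈ ys → y ≢ x
    ∈ys⇒≢ y∈ refl = x∉ y∈

    map-ys : {f g : A → ℕ} → (∀ y → y ≢ x → f y ≡ g y) → map f ys ≡ map g ys
    map-ys eq = map-cong-local (All.tabulate (λ {y} y∈ → eq y (∈ys⇒≢ y∈)))

  -- Only the term at `x` changes. A constant `g` of 0 yields `sum-single`; `k` equal to 1 removes
  -- one signal from a count.
  sum-increase : (f g : A → ℕ) (k : ℕ) → f x ≡ k + g x → (∀ y → y ≢ x → f y ≡ g y) →
                 sum (map f xs) ≡ k + sum (map g xs)
  sum-increase f g k at off = begin
    sum (map f xs)             ≡⟨ sum-↭ (map⁺ f xs↭) ⟩
    f x + sum (map f ys)       ≡⟨ cong₂ _+_ at (cong sum (map-ys off)) ⟩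
    k + g x + sum (map g ys)   ≡⟨ ℕ.+-assoc k _ _ ⟩
    k + (g x + sum (map g ys)) ≡⟨ cong (k ℕ.+_) (sum-↭ (map⁺ g xs↭)) ⟨
    k + sum (map g xs)         ∎
    where open ≡-Reasoning

  product-increase : (f g : A → ℕ) (k : ℕ) → f x ≡ k * g x → (∀ y → y ≢ x → f y ≡ g y) →
                     product (map f xs) ≡ k * product (map g xs)
  product-increase f g k at off = begin
    product (map f xs)             ≡⟨ product-↭ (map⁺ f xs↭) ⟩
    f x * product (map f ys)       ≡⟨ cong₂ _*_ at (cong product (map-ys off)) ⟩
    k * g x * product (map g ys)   ≡⟨ ℕ.*-assoc k _ _ ⟩
    k * (g x * product (map g ys)) ≡⟨ cong (k *_) (product-↭ (map⁺ g xs↭)) ⟨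
    k * product (map g xs)         ∎
    where open ≡-Reasoning

sum-zero : (f : A → ℕ) (xs : List A) → (∀ x → x ∈ xs → f x ≡ 0) → sum (map f xs) ≡ 0
sum-zero f []       eq = refl
sum-zero f (x ∷ xs) eq = cong₂ _+_ (eq x (here refl)) (sum-zero f xs (λ y → eq y ∘ there))

sum-zero⁻ : (f : A → ℕ) (xs : List A) → sum (map f xs) ≡ 0 → ∀ {x} → x ∈ xs → f x ≡ 0
sum-zero⁻ f (x ∷ xs) eq (here refl) = ℕ.m+n≡0⇒m≡0 (f x) eq
sum-zero⁻ f (x ∷ xs) eq (there y∈)  = sum-zero⁻ f xs (ℕ.m+n≡0⇒n≡0 (f x) eq) y∈

sum-map-+ : (f g : A → ℕ) (xs : List A) →
            sum (map (λ x → f x + g x) xs) ≡ sum (map f xs) + sum (map g xs)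
sum-map-+ f g []       = refl
sum-map-+ f g (x ∷ xs) =
  trans (cong (_+_ (f x + g x)) (sum-map-+ f g xs)) (interchange ℕ.+-commutativeSemigroup (f x) (g x) _ _)

sum-map-* : (f : A → ℕ) (k : ℕ) (xs : List A) → sum (map (λ x → f x * k) xs) ≡ sum (map f xs) * k
sum-map-* f k []       = refl
sum-map-* f k (x ∷ xs) =
  trans (cong (f x * k ℕ.+_) (sum-map-* f k xs)) (sym (ℕ.*-distribʳ-+ k (f x) _))

sum-single : {x : A} {xs : List A} → Unique xs → x ∈ xs →
             (f : A → ℕ) → (∀ y → y ≢ x → f y ≡ 0) → sum (map f xs) ≡ f x
sum-single {x = x} {xs} u x∈xs f off = begin
  sum (map f xs)                   ≡⟨ sum-increase u x∈xs f (λ _ → 0) (f x) (sym (ℕ.+-identityʳ _)) off ⟩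
  f x + sum (map (λ _ → 0) xs)     ≡⟨ cong (f x ℕ.+_) (sum-zero (λ _ → 0) xs (λ _ _ → refl)) ⟩
  f x + 0                          ≡⟨ ℕ.+-identityʳ _ ⟩
  f x                              ∎
  where open ≡-Reasoning

length-filter-∷ : {P : Pred A 0ℓ} (P? : Decidable P) → ∀ x xs →
                  length (filter P? (x ∷ xs)) ≡ indicator (P? x) + length (filter P? xs)
length-filter-∷ P? x xs with does (P? x)
... | true  = refl
... | false = refl

module _ {P : Pred A 0ℓ} (P? : Decidable P) where

  length-filter-map : (f : B → A) (xs : List B) →
                      length (filter P? (map f xs)) ≡ length (filter (P? ∘ f) xs)
  length-filter-map f []       = refl
  length-filter-map f (x ∷ xs) with does (P? (f x))
  ... | true  = cong suc (length-filter-map f xs)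
  ... | false = length-filter-map f xs

  length-filter-cartesianProductWith : (f : B → C → A) (xs : List B) (ys : List C) →
    length (filter P? (cartesianProductWith f xs ys)) ≡ sum (map (λ x → length (filter (P? ∘ f x) ys)) xs)
  length-filter-cartesianProductWith f []       ys = refl
  length-filter-cartesianProductWith f (x ∷ xs) ys = begin
    length (filter P? (map (f x) ys ++ zs))                  ≡⟨ cong length (filter-++ P? (map (f x) ys) zs) ⟩
    length (filter P? (map (f x) ys) ++ filter P? zs)        ≡⟨ length-++ (filter P? (map (f x) ys)) ⟩
    length (filter P? (map (f x) ys)) + length (filter P? zs)
      ≡⟨ cong₂ _+_ (length-filter-map (f x) ys) (length-filter-cartesianProductWith f xs ys) ⟩
    _                                                        ∎
    where
    open ≡-Reasoning
    zs = cartesianProductWith f xs ys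

  length-filter-mono : {Q : Pred A 0ℓ} (Q? : Decidable Q) (xs : List A) →
    (∀ x → x ∈ xs → P x → Q x) → length (filter P? xs) ≤ length (filter Q? xs)
  length-filter-mono Q? []       sub = z≤n
  length-filter-mono Q? (x ∷ xs) sub = begin
    length (filter P? (x ∷ xs))                  ≡⟨ length-filter-∷ P? x xs ⟩
    indicator (P? x) + length (filter P? xs)
      ≤⟨ ℕ.+-mono-≤ (indicator-mono (P? x) (Q? x) (sub x (here refl)))
                    (length-filter-mono Q? xs (λ y → sub y ∘ there)) ⟩
    indicator (Q? x) + length (filter Q? xs)     ≡⟨ length-filter-∷ Q? x xs ⟨
    length (filter Q? (x ∷ xs))                  ∎
    where open ℕ.≤-Reasoning

-- Induction on `xs`: a new `x` enters exactly one fibre, since `f x` occurs exactly once in `ys`.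
count-fibres : (_≟′_ : DecidableEquality B) {Q : Pred B 0ℓ} (Q? : Decidable Q)
               (f : A → B) (xs : List A) {ys : List B} → Unique ys → (∀ x → x ∈ xs → f x ∈ ys) →
               length (filter (Q? ∘ f) xs) ≡
               sum (map (λ y → length (filter (λ x → f x ≟′ y) xs) * indicator (Q? y)) ys)
count-fibres _≟′_ Q? f []       {ys} u f∈ys = sym (sum-zero _ ys (λ _ _ → refl))
count-fibres _≟′_ Q? f (x ∷ xs) {ys} u f∈ys = begin
  length (filter (Q? ∘ f) (x ∷ xs))                           ≡⟨ length-filter-∷ (Q? ∘ f) x xs ⟩
  indicator (Q? (f x)) + length (filter (Q? ∘ f) xs)
    ≡⟨ cong₂ _+_ (sym at) (count-fibres _≟′_ Q? f xs u (λ y → f∈ys y ∘ there)) ⟩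
  sum (map g ys) + sum (map rest ys)                          ≡⟨ sum-map-+ g rest ys ⟨
  sum (map (λ y → g y + rest y) ys)                           ≡⟨ cong sum (map-cong combine ys) ⟩
  _                                                           ∎
  where
  open ≡-Reasoning
  g rest : _ → ℕ
  g y    = indicator (f x ≟′ y) * indicator (Q? y)
  rest y = length (filter (λ z → f z ≟′ y) xs) * indicator (Q? y)
  at : sum (map g ys) ≡ indicator (Q? (f x))
  at = begin
    sum (map g ys)            ≡⟨ sum-single u (f∈ys x (here refl)) g
                         (λ y y≢ → cong (_* indicator (Q? y)) (indicator-no (f x ≟′ y) (y≢ ∘ sym))) ⟩
    g (f x)                   ≡⟨ cong (_* indicator (Q? (f x))) (indicator-yes (f x ≟′ f x) refl) ⟩
    1 * indicator (Q? (f x))  ≡⟨ ℕ.*-identityˡ _ ⟩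
    indicator (Q? (f x))      ∎
  combine : ∀ y → g y + rest y ≡ length (filter (λ z → f z ≟′ y) (x ∷ xs)) * indicator (Q? y)
  combine y = trans (sym (ℕ.*-distribʳ-+ (indicator (Q? y)) (indicator (f x ≟′ y)) _))
                    (cong (_* indicator (Q? y)) (sym (length-filter-∷ (λ z → f z ≟′ y) x xs)))

-- Multinomial coefficients.

occurrences : ∀ {n m} → Vec (Fin n) m → Fin n → ℕ
occurrences S t = count (_≟ t) S

occurrences-∷ : ∀ {n m} s (S : Vec (Fin n) m) t →
                occurrences (s ∷ S) t ≡ indicator (s ≟ t) + occurrences S t
occurrences-∷ s S t with does (s ≟ t)
... | true  = refl
... | false = refl

HasCounts : ∀ {n m} → (Fin n → ℕ) → Vec (Fin n) m → Set
HasCounts c S = ∀ t → occurrences S t ≡ c t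

hasCounts? : ∀ {n m} (c : Fin n → ℕ) (S : Vec (Fin n) m) → Dec (HasCounts c S)
hasCounts? c S = Fin.all? λ t → occurrences S t ℕ.≟ c t

-- Induction on the number of signals, by cases on the first signal `s`: the others must have the
-- counts `c` lowered by one at `s`, and (k+1)! = (k+1) k!, so `s` contributes `c s * m !`. As the
-- counts add up to `suc m`, summing over `s` gives `suc m !`. The product form avoids division.
multinomial : ∀ {n} m {xs : List (Fin n)} → Unique xs → (c : Fin n → ℕ) →
              (∀ t → t ∉ xs → c t ≡ 0) → sum (map c xs) ≡ m →
              length (filter (hasCounts? c) (vectors xs m)) * product (map (λ t → c t !) xs) ≡ m !
multinomial {n} zero {xs} u c off Σc = begin
  length (filter (hasCounts? c) ([] ∷ [])) * p  ≡⟨ cong (_* p) (length-filter-∷ (hasCounts? c) [] []) ⟩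
  (indicator (hasCounts? c []) + 0) * p
    ≡⟨ cong (λ k → (k + 0) * p) (indicator-yes (hasCounts? c []) (λ t → sym (c≡0 t))) ⟩
  1 * p                                         ≡⟨ ℕ.*-identityˡ p ⟩
  p                                             ≡⟨ ones xs ⟩
  1                                             ∎
  where
  open ≡-Reasoning
  open import Data.List.Membership.DecPropositional (_≟_ {n}) using (_∈?_)
  p = product (map (λ t → c t !) xs)
  c≡0 : ∀ t → c t ≡ 0
  c≡0 t with t ∈? xs
  ... | yes t∈ = sum-zero⁻ c xs Σc t∈
  ... | no  t∉ = off t t∉
  ones : ∀ ys → product (map (λ t → c t !) ys) ≡ 1
  ones []       = refl
  ones (y ∷ ys) = cong₂ _*_ (cong _! (c≡0 y)) (ones ys)
multinomial {n} (suc m) {xs} u c off Σc = begin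
  length (filter (hasCounts? c) (vectors xs (suc m))) * p
    ≡⟨ cong (_* p) (length-filter-cartesianProductWith (hasCounts? c) _∷_ xs (vectors xs m)) ⟩
  sum (map N xs) * p                 ≡⟨ sum-map-* N p xs ⟨
  sum (map (λ s → N s * p) xs)       ≡⟨ cong sum (map-cong-local (All.tabulate (λ {s} s∈ → first s s∈))) ⟩
  sum (map (λ s → c s * m !) xs)     ≡⟨ sum-map-* c (m !) xs ⟩
  sum (map c xs) * m !               ≡⟨ cong (_* m !) Σc ⟩
  suc m !                            ∎
  where
  open ≡-Reasoning
  p = product (map (λ t → c t !) xs)
  N : Fin n → ℕ
  N s = length (filter (hasCounts? c ∘ (s ∷_)) (vectors xs m))
  first : ∀ s → s ∈ xs → N s * p ≡ c s * m !
  first s s∈ with c s in cs≡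
  ... | zero  = cong (λ ys → length ys * p) 
    (filter-none (hasCounts? c ∘ (s ∷_)) {vectors xs m} (All.tabulate λ {S} _ → impossible S))
    where
    impossible : ∀ S → ¬ HasCounts c (s ∷ S)
    impossible S eq with () ← begin
      0                                    ≡⟨ cs≡ ⟨
      c s                                  ≡⟨ eq s ⟨
      occurrences (s ∷ S) s                ≡⟨ occurrences-∷ s S s ⟩
      indicator (s ≟ s) + occurrences S s  ≡⟨ cong (_+ occurrences S s) (indicator-yes (s ≟ s) refl) ⟩
      suc (occurrences S s)                ∎
  ... | suc k = begin
    N s * p
      ≡⟨ cong₂ _*_ (cong length (filter-≐ (hasCounts? c ∘ (s ∷_)) (hasCounts? c′)
           ((λ {S} → to S) , (λ {S} → from S)) (vectors xs m))) p≡ ⟩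
    N′ * (suc k * p′)              ≡⟨ x∙yz≈y∙xz ℕ.*-commutativeSemigroup N′ (suc k) p′ ⟩
    suc k * (N′ * p′)              ≡⟨ cong (suc k *_) (multinomial m u c′ off′ Σc′) ⟩
    suc k * m !                    ∎
    where
    c′ : Fin n → ℕ
    c′ t = if does (s ≟ t) then k else c t
    c′s : c′ s ≡ k
    c′s = cong (if_then k else c s) (dec-true (s ≟ s) refl)
    c′t : ∀ t → t ≢ s → c′ t ≡ c t
    c′t t t≢ = cong (if_then k else c t) (dec-false (s ≟ t) (t≢ ∘ sym))
    c≡ : ∀ t → c t ≡ indicator (s ≟ t) + c′ t
    c≡ t with s ≟ t
    ... | yes refl = cs≡
    ... | no _     = refl
    N′ = length (filter (hasCounts? c′) (vectors xs m))
    p′ = product (map (λ t → c′ t !) xs)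
    p≡ : p ≡ suc k * p′
    p≡ = product-increase u s∈ _ _ (suc k)
           (trans (cong _! cs≡) (cong (λ j → suc k * j !) (sym c′s))) (λ t t≢ → cong _! (sym (c′t t t≢)))
    Σc′ : sum (map c′ xs) ≡ m
    Σc′ = ℕ.suc-injective (trans (sym (sum-increase u s∈ c c′ 1 (trans cs≡ (cong suc (sym c′s)))
                                       (λ t t≢ → sym (c′t t t≢)))) Σc)
    off′ : ∀ t → t ∉ xs → c′ t ≡ 0
    off′ t t∉ = trans (c′t t λ { refl → t∉ s∈ }) (off t t∉)
    to : ∀ S → HasCounts c (s ∷ S) → HasCounts c′ S
    to S eq t = ℕ.+-cancelˡ-≡ (indicator (s ≟ t)) _ _
                  (trans (sym (occurrences-∷ s S t)) (trans (eq t) (c≡ t)))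
    from : ∀ S → HasCounts c′ S → HasCounts c (s ∷ S)
    from S eq t = trans (occurrences-∷ s S t) (trans (cong (indicator (s ≟ t) ℕ.+_) (eq t)) (sym (c≡ t)))

-- Histories

-- An arbitrary operation covers both sums of counts and products of factorials: the skipped terms
-- equal the left identity `e`.
foldr-map-filter : (_∙_ : B → B → B) (e : B) → (∀ y → e ∙ y ≡ y) →
                   {P : Pred A 0ℓ} (P? : Decidable P) (f : A → B) → (∀ x → ¬ P x → f x ≡ e) →
                   ∀ xs → foldr _∙_ e (map f (filter P? xs)) ≡ foldr _∙_ e (map f xs)
foldr-map-filter _∙_ e idˡ P? f off []       = refl
foldr-map-filter _∙_ e idˡ P? f off (x ∷ xs) with P? x
... | yes _ = cong (f x ∙_) (foldr-map-filter _∙_ e idˡ P? f off xs)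
... | no ¬p = trans (foldr-map-filter _∙_ e idˡ P? f off xs)
                    (sym (trans (cong (_∙ foldr _∙_ e (map f xs)) (off x ¬p)) (idˡ _)))

mapMaybe-unique : (f : A → Maybe B) → (∀ x y {z} → f x ≡ just z → f y ≡ just z → x ≡ y) →
                  ∀ {xs} → Unique xs → Unique (mapMaybe f xs)
mapMaybe-unique f inj []                = []
mapMaybe-unique f inj (_∷_ {x} x∉xs u) with f x in eq
... | nothing = mapMaybe-unique f inj u
... | just z  = All.mapMaybe⁺ (All.map⁺ (All.map (λ {y} → distinct y) x∉xs)) ∷ mapMaybe-unique f inj u
  where
  distinct : ∀ y → x ≢ y → MaybeAll.All (z ≢_) (f y)
  distinct y x≢y with f y in eq′
  ... | nothing = MaybeAll.nothing
  ... | just w  = MaybeAll.just λ { refl → x≢y (inj x y eq eq′) }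

vectors-unique : {xs : List A} → Unique xs → ∀ k → Unique (vectors xs k)
vectors-unique u zero    = [] ∷ []
vectors-unique u (suc k) = Unique.cartesianProductWith⁺ _∷_ ∷-injective u (vectors-unique u k)

∈-vectors⁺ : {xs : List A} (v : Vec A n) → (∀ i → lookup v i ∈ xs) → v ∈ vectors xs n
∈-vectors⁺ []      v∈ = here refl
∈-vectors⁺ (x ∷ v) v∈ = ∈-cartesianProductWith⁺ _∷_ (v∈ zero) (∈-vectors⁺ v (v∈ ∘ suc))

∈-vectors⁻ : {xs : List A} {v : Vec A n} → v ∈ vectors xs n → ∀ i → lookup v i ∈ xs
∈-vectors⁻ {n = suc n} {xs} v∈ i
  with ∈-cartesianProductWith⁻ _∷_ xs (vectors xs n) v∈
∈-vectors⁻ v∈ zero    | _ , _ , x∈ , _ , refl  = x∈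
∈-vectors⁻ v∈ (suc i) | _ , _ , _ , v′∈ , refl = ∈-vectors⁻ v′∈ i

∈-upTo⁺ : {t i : Fin n} → t Fin.≤ i → t ∈ upTo i
∈-upTo⁺ {t = t} {i} = ∈-filter⁺ (_≤? i) (∈-allFin t)

∈-upTo⁻ : {t i : Fin n} → t ∈ upTo i → t Fin.≤ i
∈-upTo⁻ {n} {i = i} t∈ = proj₂ (∈-filter⁻ (_≤? i) {xs = allFin n} t∈)

upTo-unique : (i : Fin n) → Unique (upTo i)
upTo-unique {n} i = Unique.filter⁺ (_≤? i) (Unique.allFin⁺ n)

-- `valid` is irrelevant, so a usable proof is recovered by recomputing the decidable predicate.
isHistory : (h : History n m) → IsHistory (counts h) (ℓ h)
isHistory (history c l p) = recompute (isHistory? c l) p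

history-cong : {h h′ : History n m} → counts h ≡ counts h′ → ℓ h ≡ ℓ h′ → h ≡ h′
history-cong {h = history _ _ _} {history _ _ _} refl refl = refl

_≟ʰ_ : DecidableEquality (History n m)
h ≟ʰ h′ = map′ (λ (p , q) → history-cong p q) (λ { refl → refl , refl })
               (≡-dec _≟_ (counts h) (counts h′) ×-dec (ℓ h ≟ ℓ h′))

lookup-ext : {xs ys : Vec A n} → (∀ i → lookup xs i ≡ lookup ys i) → xs ≡ ys
lookup-ext {xs = xs} {ys} eq =
  trans (sym (tabulate∘lookup xs)) (trans (tabulate-cong eq) (tabulate∘lookup ys))

-- `ℓ` is the last time with a positive count: were `ℓ g` earlier than `ℓ g′`, the count at `ℓ g′`
-- would be positive in `g′` and zero in `g`.
history-ext : {h h′ : History n m} → (∀ t → signals (counts h) t ≡ signals (counts h′) t) → h ≡ h′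
history-ext {h = h} {h′} eq = history-cong (lookup-ext (Fin.toℕ-injective ∘ eq)) ℓ≡
  where
  silent-after : ∀ {g g′ : History _ _} → (∀ t → signals (counts g) t ≡ signals (counts g′) t) → ¬ ℓ g Fin.< ℓ g′
  silent-after {g} {g′} eq′ ℓ<ℓ′ with 0<c , _ ← isHistory g′ | _ , silent , _ ← isHistory g =
    ℕ.n≮0 (subst (0 ℕ.<_) (trans (sym (eq′ (ℓ g′))) (silent _ ℓ<ℓ′)) 0<c)
  ℓ≡ : ℓ h ≡ ℓ h′
  ℓ≡ with Fin.<-cmp (ℓ h) (ℓ h′)
  ... | tri< l<l′ _ _ = contradiction l<l′ (silent-after {h} {h′} eq)
  ... | tri≈ _ l≡l′ _ = l≡l′
  ... | tri> _ _ l>l′ = contradiction l>l′ (silent-after {h′} {h} (sym ∘ eq))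

∈-histories : (h : History n m) → h ∈ histories n m
∈-histories {n} {m} (history c l valid) =
  Any.mapMaybe⁺ _ (cartesianProduct (vectors (allFin (suc m)) n) (allFin n))
    (Any.map⁺ (lose (∈-cartesianProduct⁺ (∈-vectors⁺ c (λ _ → ∈-allFin _)) (∈-allFin l)) found))
  where
  found : MaybeAny.Any (history c l valid ≡_)
            (Maybe.map (λ p → history c l p) (dec⇒maybe (isHistory? c l)))
  -- The enumeration decides validity afresh. The recomputed proof excludes a negative answer, and
  -- irrelevance identifies the two histories.
  found with isHistory? c l | recompute (isHistory? c l) valid
  ... | yes _ | _ = MaybeAny.just refl
  ... | no ¬p | p = contradiction p ¬p

histories-unique : ∀ n m → Unique (histories n m)
histories-unique n m = mapMaybe-unique _ inj
  (Unique.cartesianProduct⁺ (vectors-unique (Unique.allFin⁺ (suc m)) n) (Unique.allFin⁺ n))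
  where
  -- The enumerating map keeps the pair `(c , l)`, so it is injective where it is defined.
  origin : ∀ c l {h : History n m} →
           Maybe.map (λ p → history c l p) (dec⇒maybe (isHistory? c l)) ≡ just h →
           (c , l) ≡ (counts h , ℓ h)
  origin c l eq with isHistory? c l
  origin c l refl | yes _ = refl
  inj : ∀ _ _ {h : History n m} → _ → _ → _
  inj (c , l) (c′ , l′) eq eq′ = trans (origin c l eq) (sym (origin c′ l′ eq′))

-- The history of a tuple of signal times.

sum-occurrences-∷ : ∀ s (S : Vec (Fin n) m) xs → sum (map (occurrences (s ∷ S)) xs) ≡
                    sum (map (λ t → indicator (s ≟ t)) xs) + sum (map (occurrences S) xs)
sum-occurrences-∷ s S xs = trans (cong sum (map-cong (occurrences-∷ s S) xs)) (sum-map-+ _ _ xs)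

sum-indicator-∈ : {s : Fin n} {xs : List (Fin n)} → Unique xs → s ∈ xs →
                  sum (map (λ t → indicator (s ≟ t)) xs) ≡ 1
sum-indicator-∈ {s = s} u s∈ =
  trans (sum-single u s∈ _ (λ t t≢ → indicator-no (s ≟ t) (t≢ ∘ sym))) (indicator-yes (s ≟ s) refl)

sum-indicator-∉ : {s : Fin n} {xs : List (Fin n)} → s ∉ xs →
                  sum (map (λ t → indicator (s ≟ t)) xs) ≡ 0
sum-indicator-∉ {s = s} s∉ = sum-zero _ _ (λ t t∈ → indicator-no (s ≟ t) λ { refl → s∉ t∈ })

module _ {n : ℕ} {xs : List (Fin n)} (u : Unique xs) where

  open import Data.List.Membership.DecPropositional (_≟_ {n}) using (_∈?_)

  sum-occurrences : (S : Vec (Fin n) m) → (∀ j → lookup S j ∈ xs) → sum (map (occurrences S) xs) ≡ m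
  sum-occurrences []      S∈ = sum-zero _ xs (λ _ _ → refl)
  sum-occurrences (s ∷ S) S∈ = trans (sum-occurrences-∷ s S xs)
    (cong₂ _+_ (sum-indicator-∈ u (S∈ zero)) (sum-occurrences S (S∈ ∘ suc)))

  sum-occurrences≤ : (S : Vec (Fin n) m) → sum (map (occurrences S) xs) ≤ m
  sum-occurrences≤ []      = ℕ.≤-reflexive (sum-zero _ xs (λ _ _ → refl))
  sum-occurrences≤ (s ∷ S) =
    subst (_≤ _) (sym (sum-occurrences-∷ s S xs)) (ℕ.+-mono-≤ indicators (sum-occurrences≤ S))
    where
    indicators : sum (map (λ t → indicator (s ≟ t)) xs) ≤ 1
    indicators with s ∈? xs
    ... | yes s∈ = ℕ.≤-reflexive (sum-indicator-∈ u s∈)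
    ... | no  s∉ = ℕ.≤-trans (ℕ.≤-reflexive (sum-indicator-∉ s∉)) z≤n

  -- A signal adds 1 to the sum if it lies in `xs` and 0 otherwise. If `s` lay outside, the
  -- remaining `m` signals would have to account for `suc m`, against `sum-occurrences≤`.
  sum-occurrences⁻ : (S : Vec (Fin n) m) → sum (map (occurrences S) xs) ≡ m → ∀ j → lookup S j ∈ xs
  sum-occurrences⁻ {suc m} (s ∷ S) eq j with s ∈? xs
  sum-occurrences⁻ {suc m} (s ∷ S) eq zero    | yes s∈ = s∈
  sum-occurrences⁻ {suc m} (s ∷ S) eq (suc j) | yes s∈ = sum-occurrences⁻ S
    (ℕ.suc-injective (trans (sym (trans (sum-occurrences-∷ s S xs)
                                      (cong (_+ _) (sum-indicator-∈ u s∈)))) eq)) j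
  sum-occurrences⁻ {suc m} (s ∷ S) eq j       | no s∉  =
    contradiction (subst (_≤ m) (trans (sym (trans (sum-occurrences-∷ s S xs)
                                                   (cong (_+ _) (sum-indicator-∉ s∉)))) eq)
                         (sum-occurrences≤ S)) ℕ.1+n≰n

occurrences-zero : (S : Vec (Fin n) m) {t : Fin n} → (∀ j → lookup S j ≢ t) → occurrences S t ≡ 0
occurrences-zero []      S≢ = refl
occurrences-zero (s ∷ S) {t} S≢ = trans (occurrences-∷ s S t)
  (cong₂ _+_ (indicator-no (s ≟ t) (S≢ zero)) (occurrences-zero S (S≢ ∘ suc)))

occurrences-positive : (S : Vec (Fin n) m) → ∀ j → 0 ℕ.< occurrences S (lookup S j)
occurrences-positive (s ∷ S) zero    = subst (0 ℕ.<_)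
  (sym (trans (occurrences-∷ s S s) (cong (_+ occurrences S s) (indicator-yes (s ≟ s) refl)))) (s≤s z≤n)
occurrences-positive (s ∷ S) (suc j) = subst (0 ℕ.<_) (sym (occurrences-∷ s S _))
  (ℕ.≤-trans (occurrences-positive S j) (ℕ.m≤n+m _ _))

-- The index `suc m` is where m ≥ 1 enters: without signals there is no last one, hence no
-- `historyOf`.
latest : (S : Vec (Fin n) (suc m)) → ∃[ i ] (∀ j → lookup S j Fin.≤ lookup S i)
latest (s ∷ [])     = zero , λ { zero → ℕ.≤-refl }
latest (s ∷ S@(_ ∷ _)) with latest S
... | i , max with Fin.≤-total s (lookup S i)
...   | inj₁ s≤ = suc i , λ { zero → s≤ ; (suc j) → max j }
...   | inj₂ ≤s = zero , λ { zero → ℕ.≤-refl ; (suc j) → ℕ.≤-trans (max j) ≤s }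

counting : Vec (Fin n) m → Vec (Fin (suc m)) n
counting S = tabulate λ t → fromℕ< (s≤s (count≤n (_≟ t) S))

signals-counting : (S : Vec (Fin n) m) → ∀ t → signals (counting S) t ≡ occurrences S t
signals-counting S t = trans (cong toℕ (lookup∘tabulate _ t)) (Fin.toℕ-fromℕ< _)

historyOf : Vec (Fin n) (suc m) → History n (suc m)
historyOf {n} {m} S = history (counting S) last (positive , silent , total)
  where
  last = lookup S (proj₁ (latest S))
  positive : 0 ℕ.< signals (counting S) last
  positive = subst (0 ℕ.<_) (sym (signals-counting S last)) (occurrences-positive S _)
  silent : ∀ t → last Fin.< t → signals (counting S) t ≡ 0
  silent t l<t = trans (signals-counting S t)
    (occurrences-zero S λ { j refl → ℕ.<⇒≱ l<t (proj₂ (latest S) j) })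
  total : sum (map (signals (counting S)) (upTo last)) ≡ suc m
  total = trans (cong sum (map-cong (signals-counting S) (upTo last)))
    (sum-occurrences (upTo-unique last) S (∈-upTo⁺ ∘ proj₂ (latest S)))

historyOf-counts : (S : Vec (Fin n) (suc m)) → HasCounts (signals (counts (historyOf S))) S
historyOf-counts S t = sym (signals-counting S t)

ℓ-historyOf : (S : Vec (Fin n) (suc m)) {i : Fin n} → S ∈ vectors (upTo i) (suc m) → ℓ (historyOf S) Fin.≤ i
ℓ-historyOf S S∈ = ∈-upTo⁻ (∈-vectors⁻ S∈ _)

-- A history is determined by its entries up to ℓ, since these already add up to the number of signals.
historyOf-prefix : (h : History n (suc m)) (S : Vec (Fin n) (suc m)) →
                   (∀ t → t Fin.≤ ℓ h → occurrences S t ≡ signals (counts h) t) → historyOf S ≡ h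
historyOf-prefix {m = m} h S match with _ , silent , total ← isHistory h =
  history-ext λ t → trans (signals-counting S t) (match′ t)
  where
  within : ∀ j → lookup S j Fin.≤ ℓ h
  within j = ∈-upTo⁻ (sum-occurrences⁻ (upTo-unique (ℓ h)) S
    (trans (cong sum (map-cong-local (All.tabulate λ t∈ → match _ (∈-upTo⁻ t∈)))) total) j)
  match′ : ∀ t → occurrences S t ≡ signals (counts h) t
  match′ t with t ≤? ℓ h
  ... | yes t≤ = match t t≤
  ... | no  t≰ = trans (occurrences-zero S λ { j refl → t≰ (within j) }) (sym (silent t (ℕ.≰⇒> t≰)))

#orderings : Fin n → History n (suc m) → ℕ
#orderings {m = m} i h = length (filter (λ S → historyOf S ≟ʰ h) (vectors (upTo i) (suc m)))

-- Having history `h` amounts to having its counts, so `multinomial` applies with the times up to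
-- `i`. Passing from `upTo (ℓ h)` to `upTo i` adds only zero counts and factors 0! = 1.
#orderings-factorials : (i : Fin n) (h : History n (suc m)) → ℓ h Fin.≤ i →
                        #orderings i h * factorials h ≡ suc m !
#orderings-factorials {n} {m} i h ℓ≤i with _ , silent , total ← isHistory h = begin
  #orderings i h * factorials h
    ≡⟨ cong₂ _*_ (cong length (filter-≐ _ (hasCounts? c) ((λ { {S} refl → historyOf-counts S }) ,
                                                         (λ {S} eq → historyOf-prefix h S (λ t _ → eq t)))
                                        (vectors (upTo i) (suc m))))
                 (fold-upTo _*_ 1 ℕ.*-identityˡ (λ t → c t !) (λ t ℓ<t → cong _! (silent t ℓ<t))) ⟩
  length (filter (hasCounts? c) (vectors (upTo i) (suc m))) * product (map (λ t → c t !) (upTo i))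
    ≡⟨ multinomial (suc m) (upTo-unique i) c
         (λ t t∉ → silent t (ℕ.≤-<-trans ℓ≤i (ℕ.≰⇒> (t∉ ∘ ∈-upTo⁺))))
         (trans (sym (fold-upTo _+_ 0 (λ _ → refl) c silent)) total) ⟩
  suc m ! ∎
  where
  open ≡-Reasoning
  c = signals (counts h)
  fold-upTo : (_∙_ : ℕ → ℕ → ℕ) (e : ℕ) → (∀ y → e ∙ y ≡ y) →
              (f : Fin n → ℕ) → (∀ t → ℓ h Fin.< t → f t ≡ e) →
              foldr _∙_ e (map f (upTo (ℓ h))) ≡ foldr _∙_ e (map f (upTo i))
  fold-upTo _∙_ e idˡ f off = trans
    (foldr-map-filter _∙_ e idˡ (_≤? ℓ h) f (λ t t≰ → off t (ℕ.≰⇒> t≰)) (allFin n))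
    (sym (foldr-map-filter _∙_ e idˡ (_≤? i) f (λ t t≰ → off t (ℕ.≤-<-trans ℓ≤i (ℕ.≰⇒> t≰))) (allFin n)))

historiesUpTo : (i : Fin n) → List (History n m)
historiesUpTo i = filter (λ h → ℓ h ≤? i) (histories _ _)

∈-historiesUpTo⁻ : {i : Fin n} {h : History n m} → h ∈ historiesUpTo i → ℓ h Fin.≤ i
∈-historiesUpTo⁻ {n} {m} {i} h∈ = proj₂ (∈-filter⁻ (λ h → ℓ h ≤? i) {xs = histories n m} h∈)

-- The fibres of `historyOf` on tuples from `upTo i` have sizes `#orderings i h`; signals up to `i`
-- only produce histories with `ℓ h` at most `i`.
count-historyOf : (i : Fin n) {Q : Pred (History n (suc m)) 0ℓ} (Q? : Decidable Q) →
  length (filter (Q? ∘ historyOf) (vectors (upTo i) (suc m))) ≡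
  sum (map (λ h → #orderings i h * indicator (Q? h)) (historiesUpTo i))
count-historyOf {n} {m} i Q? = count-fibres _≟ʰ_ Q? historyOf (vectors (upTo i) (suc m))
  (Unique.filter⁺ (λ h → ℓ h ≤? i) (histories-unique n (suc m)))
  (λ S S∈ → ∈-filter⁺ (λ h → ℓ h ≤? i) (∈-histories _) (ℓ-historyOf S S∈))

-- Rational arithmetic

-- `toℚᵘ` reflects equality, so the identity can be checked on unnormalised fractions, where no gcd
-- occurs.
fromℚᵘ-homo-+ : ∀ p q → fromℚᵘ p ℚ.+ fromℚᵘ q ≡ fromℚᵘ (p ℚᵘ.+ q)
fromℚᵘ-homo-+ p q = ℚ.toℚᵘ-injective (begin
  toℚᵘ (fromℚᵘ p ℚ.+ fromℚᵘ q)          ≈⟨ ℚ.toℚᵘ-homo-+ (fromℚᵘ p) (fromℚᵘ q) ⟩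
  toℚᵘ (fromℚᵘ p) ℚᵘ.+ toℚᵘ (fromℚᵘ q)  ≈⟨ ℚᵘ.+-cong (ℚ.toℚᵘ-fromℚᵘ p) (ℚ.toℚᵘ-fromℚᵘ q) ⟩
  p ℚᵘ.+ q                              ≈⟨ ℚ.toℚᵘ-fromℚᵘ (p ℚᵘ.+ q) ⟨
  toℚᵘ (fromℚᵘ (p ℚᵘ.+ q))              ∎)
  where open ℚᵘ.≃-Reasoning

fromℚᵘ-homo-* : ∀ p q → fromℚᵘ p ℚ.* fromℚᵘ q ≡ fromℚᵘ (p ℚᵘ.* q)
fromℚᵘ-homo-* p q = ℚ.toℚᵘ-injective (begin
  toℚᵘ (fromℚᵘ p ℚ.* fromℚᵘ q)          ≈⟨ ℚ.toℚᵘ-homo-* (fromℚᵘ p) (fromℚᵘ q) ⟩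
  toℚᵘ (fromℚᵘ p) ℚᵘ.* toℚᵘ (fromℚᵘ q)  ≈⟨ ℚᵘ.*-cong (ℚ.toℚᵘ-fromℚᵘ p) (ℚ.toℚᵘ-fromℚᵘ q) ⟩
  p ℚᵘ.* q                              ≈⟨ ℚ.toℚᵘ-fromℚᵘ (p ℚᵘ.* q) ⟨
  toℚᵘ (fromℚᵘ (p ℚᵘ.* q))              ∎)
  where open ℚᵘ.≃-Reasoning

fromℚᵘ-mono-≤ : ∀ {p q} → p ℚᵘ.≤ q → fromℚᵘ p ℚ.≤ fromℚᵘ q
fromℚᵘ-mono-≤ {p} {q} p≤q = ℚ.toℚᵘ-cancel-≤
  (ℚᵘ.≤-respʳ-≃ (ℚᵘ.≃-sym (ℚ.toℚᵘ-fromℚᵘ q)) (ℚᵘ.≤-respˡ-≃ (ℚᵘ.≃-sym (ℚ.toℚᵘ-fromℚᵘ p)) p≤q))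

-- Opaque: the conversion checker would otherwise evaluate the gcds of symbolic fractions.
opaque
  fromℕ : ℕ → ℚ
  fromℕ k = (+ k) / 1

  fromℕ-+ : ∀ a b → fromℕ (a + b) ≡ fromℕ a ℚ.+ fromℕ b
  fromℕ-+ a b = sym (trans (fromℚᵘ-homo-+ (mkℚᵘ (+ a) 0) (mkℚᵘ (+ b) 0))
    (ℚ.fromℚᵘ-cong {mkℚᵘ (+ a) 0 ℚᵘ.+ mkℚᵘ (+ b) 0} {mkℚᵘ (+ (a + b)) 0}
      (*≡* (cong (ℤ._* + 1) (cong₂ ℤ._+_ (ℤ.*-identityʳ (+ a)) (ℤ.*-identityʳ (+ b)))))))

  fromℕ-* : ∀ a b → fromℕ (a * b) ≡ fromℕ a ℚ.* fromℕ b
  fromℕ-* a b = sym (trans (fromℚᵘ-homo-* (mkℚᵘ (+ a) 0) (mkℚᵘ (+ b) 0))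
    (ℚ.fromℚᵘ-cong {mkℚᵘ (+ a) 0 ℚᵘ.* mkℚᵘ (+ b) 0} {mkℚᵘ (+ (a * b)) 0}
      (*≡* (cong (ℤ._* + 1) (sym (ℤ.pos-* a b))))))

  -- Cross-multiplication. It turns the multinomial coefficient in `lam` into the number
  -- `#orderings` of tuples.
  fromℕ-quotient : ∀ {a b d} .{{_ : NonZero d}} → b * d ≡ a → (+ a) / d ≡ fromℕ b
  fromℕ-quotient {a} {b} {suc d} eq = ℚ.fromℚᵘ-cong {mkℚᵘ (+ a) d} {mkℚᵘ (+ b) 0}
    (*≡* (trans (ℤ.*-identityʳ (+ a)) (trans (cong +_ (sym eq)) (ℤ.pos-* b (suc d)))))

  /-as-* : ∀ a d .{{_ : NonZero d}} → (+ a) / d ≡ fromℕ a ℚ.* ((+ 1) / d)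
  /-as-* a (suc d) = sym (trans (fromℚᵘ-homo-* (mkℚᵘ (+ a) 0) (mkℚᵘ (+ 1) d))
    (ℚ.fromℚᵘ-cong {mkℚᵘ (+ a) 0 ℚᵘ.* mkℚᵘ (+ 1) d} {mkℚᵘ (+ a) d}
      (*≡* (cong₂ ℤ._*_ (ℤ.*-identityʳ (+ a)) (cong +_ (sym (ℕ.+-identityʳ (suc d))))))))

  fromℕ-0 : fromℕ 0 ≡ 0ℚ
  fromℕ-0 = refl

  fromℕ-1 : fromℕ 1 ≡ 1ℚ
  fromℕ-1 = refl

  0≤fromℕ : ∀ k → 0ℚ ℚ.≤ fromℕ k
  0≤fromℕ k = ℚ.nonNegative⁻¹ (fromℕ k) {{ℚ.normalize-nonNeg k 1}}

/-monoˡ-≤ : ∀ {a b} d .{{_ : NonZero d}} → a ℕ.≤ b → (+ a) / d ℚ.≤ (+ b) / d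
/-monoˡ-≤ {a} {b} (suc d) a≤b = fromℚᵘ-mono-≤ {mkℚᵘ (+ a) d} {mkℚᵘ (+ b) d}
  (*≤* (ℤ.*-monoʳ-≤-nonNeg (+ suc d) (ℤ.+≤+ a≤b)))

∑-cong : {xs : List A} {f g : A → ℚ} → (∀ x → x ∈ xs → f x ≡ g x) → ∑ xs f ≡ ∑ xs g
∑-cong {xs = []}     eq = refl
∑-cong {xs = x ∷ xs} eq = cong₂ ℚ._+_ (eq x (here refl)) (∑-cong (λ y → eq y ∘ there))

∑-mono : {xs : List A} {f g : A → ℚ} → (∀ x → x ∈ xs → f x ℚ.≤ g x) → ∑ xs f ℚ.≤ ∑ xs g
∑-mono {xs = []}     le = ℚ.≤-refl
∑-mono {xs = x ∷ xs} le = ℚ.+-mono-≤ (le x (here refl)) (∑-mono (λ y → le y ∘ there))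

∑-* : (xs : List A) (f : A → ℚ) (r : ℚ) → ∑ xs (λ x → f x ℚ.* r) ≡ ∑ xs f ℚ.* r
∑-* []       f r = sym (ℚ.*-zeroˡ r)
∑-* (x ∷ xs) f r = trans (cong (f x ℚ.* r ℚ.+_) (∑-* xs f r)) (sym (ℚ.*-distribʳ-+ r (f x) (∑ xs f)))

∑-fromℕ : (xs : List A) (f : A → ℕ) → ∑ xs (fromℕ ∘ f) ≡ fromℕ (sum (map f xs))
∑-fromℕ []       f = sym fromℕ-0
∑-fromℕ (x ∷ xs) f = trans (cong (fromℕ (f x) ℚ.+_) (∑-fromℕ xs f)) (sym (fromℕ-+ (f x) _))

module _ {f : A → ℚ} where

  ∑-nonNegative : {xs : List A} → (∀ x → x ∈ xs → 0ℚ ℚ.≤ f x) → 0ℚ ℚ.≤ ∑ xs f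
  ∑-nonNegative {[]}     0≤ = ℚ.≤-refl
  ∑-nonNegative {x ∷ xs} 0≤ = ℚ.+-mono-≤ (0≤ x (here refl)) (∑-nonNegative (λ y → 0≤ y ∘ there))

  ∑-≥-term : {xs : List A} → (∀ x → x ∈ xs → 0ℚ ℚ.≤ f x) → ∀ {x} → x ∈ xs → f x ℚ.≤ ∑ xs f
  ∑-≥-term {x ∷ xs} 0≤ (here refl) = subst (ℚ._≤ ∑ (x ∷ xs) f) (ℚ.+-identityʳ (f x))
    (ℚ.+-monoʳ-≤ (f x) (∑-nonNegative (λ y → 0≤ y ∘ there)))
  ∑-≥-term {x ∷ xs} 0≤ {y} (there y∈) = subst (ℚ._≤ ∑ (x ∷ xs) f) (ℚ.+-identityˡ (f y))
    (ℚ.+-mono-≤ (0≤ x (here refl)) (∑-≥-term (λ z → 0≤ z ∘ there) y∈))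

  -- Serves to exclude two entries 1 in one row of a feasible point, since the row sums to 1.
  ∑-≥-two : {xs : List A} → (∀ x → x ∈ xs → 0ℚ ℚ.≤ f x) → ∀ {x y} → x ∈ xs → y ∈ xs → x ≢ y →
            f x ℚ.+ f y ℚ.≤ ∑ xs f
  ∑-≥-two 0≤ (here refl) (here refl) x≢y = contradiction refl x≢y
  ∑-≥-two 0≤ {x} (here refl) (there y∈) x≢y = ℚ.+-monoʳ-≤ (f x) (∑-≥-term (λ z → 0≤ z ∘ there) y∈)
  ∑-≥-two {y ∷ ys} 0≤ {x} (there x∈) (here refl) x≢y = subst (ℚ._≤ ∑ (y ∷ ys) f) (ℚ.+-comm (f y) (f x))
    (ℚ.+-monoʳ-≤ (f y) (∑-≥-term (λ z → 0≤ z ∘ there) x∈))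
  ∑-≥-two {z ∷ zs} 0≤ {x} {y} (there x∈) (there y∈) x≢y = subst (ℚ._≤ ∑ (z ∷ zs) f) (ℚ.+-identityˡ (f x ℚ.+ f y))
    (ℚ.+-mono-≤ (0≤ z (here refl)) (∑-≥-two (λ w → 0≤ w ∘ there) x∈ y∈ x≢y))

-- Minima and maxima over finite sets.

open import Data.List.Extrema (DecTotalOrder.totalOrder ℚ.≤-decTotalOrder)
  using (argmin; argmax; f[argmin]≤f[xs]; f[xs]≤f[argmax])

minimizer : (Fin (suc n) → ℚ) → Fin (suc n)
minimizer f = argmin f zero (allFin _)

minimizer-≤ : (f : Fin (suc n) → ℚ) → ∀ i → f (minimizer f) ℚ.≤ f i
minimizer-≤ f i = All.lookup (f[argmin]≤f[xs] {f = f} zero (allFin _)) (∈-allFin i)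

-- Maximizing over one argument at a time avoids enumerating the functions.
maximum-over-functions : DecidableEquality A → (F : (A → Fin (suc n)) → ℚ) →
  (∀ {f g} → f ≗ g → F f ≡ F g) → ∀ xs f₀ →
  ∃[ f ] (∀ g → (∀ a → a ∉ xs → g a ≡ f₀ a) → F g ℚ.≤ F f)
maximum-over-functions _≟′_ F ext []       f₀ = f₀ , λ g eq → ℚ.≤-reflexive (ext λ a → eq a λ ())
maximum-over-functions {A} {n} _≟′_ F ext (x ∷ xs) f₀ = best b , bound
  where
  update : Fin (suc n) → A → Fin (suc n)
  update b a = if does (a ≟′ x) then b else f₀ a
  best : Fin (suc n) → A → Fin (suc n)
  best b = proj₁ (maximum-over-functions _≟′_ F ext xs (update b))
  b = argmax (F ∘ best) zero (allFin _)
  bound : ∀ g → (∀ a → a ∉ x ∷ xs → g a ≡ f₀ a) → F g ℚ.≤ F (best b)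
  bound g eq = ℚ.≤-trans (proj₂ (maximum-over-functions _≟′_ F ext xs (update (g x))) g agree)
                         (All.lookup (f[xs]≤f[argmax] {f = F ∘ best} zero (allFin _)) (∈-allFin (g x)))
    where
    agree : ∀ a → a ∉ xs → g a ≡ update (g x) a
    agree a a∉ with a ≟′ x
    ... | yes refl = refl
    ... | no  a≢x  = eq a λ { (here a≡x) → a≢x a≡x ; (there a∈) → a∉ a∈ }

-- The program

Rule : ℕ → ℕ → Set
Rule n m = History n m → Fin n

-- A `Rule` may name any time; `clamp` moves times before `ℓ h` up to `ℓ h`. Thus the maximization
-- can range over all functions, while `assignment` and `value` use only admissible times.
clamp : Rule n m → Rule n m
clamp τ h = if does (ℓ h ≤? τ h) then τ h else ℓ h

clamp-id : (τ : Rule n m) → ∀ h → ℓ h Fin.≤ τ h → clamp τ h ≡ τ h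
clamp-id τ h ℓ≤τ = cong (if_then τ h else ℓ h) (dec-true (ℓ h ≤? τ h) ℓ≤τ)

ℓ≤clamp : (τ : Rule n m) → ∀ h → ℓ h Fin.≤ clamp τ h
ℓ≤clamp τ h with ℓ h ≤? τ h
... | yes ℓ≤τ = subst (ℓ h Fin.≤_) (sym (clamp-id τ h ℓ≤τ)) ℓ≤τ
... | no  ℓ≰τ = Fin.≤-reflexive (sym (cong (if_then τ h else ℓ h) (dec-false (ℓ h ≤? τ h) ℓ≰τ)))

assignment : Rule n m → History n m → Fin n → ℚ
assignment τ h t = fromℕ (indicator (clamp τ h ≟ t))

value : Rule n m → Fin n → ℚ
value τ i = ∑[ h ∈ historiesUpTo i ] (lam i h ℚ.* assignment τ h i)

#wins : Rule n (suc m) → Fin n → ℕ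
#wins {m = m} τ i = length (filter (λ S → clamp τ (historyOf S) ≟ i) (vectors (upTo i) (suc m)))

opaque
  -- The probability of `k` tuples among all tuples of `m` signal times up to `i`; since `i` stands
  -- for time `suc (toℕ i)`, that is the base of the power. Opaque like `fromℕ`, with `outOf-def` to
  -- unfold it.
  outOf : Fin n → ℕ → ℕ → ℚ
  outOf i m k = ((+ k) / (suc (toℕ i) ^ m)) {{ℕ.m^n≢0 (suc (toℕ i)) m}}

  outOf-def : (i : Fin n) (m k : ℕ) → outOf i m k ≡ ((+ k) / (suc (toℕ i) ^ m)) {{ℕ.m^n≢0 (suc (toℕ i)) m}}
  outOf-def i m k = refl

  outOf-as-* : (i : Fin n) (m k : ℕ) → outOf i m k ≡ fromℕ k ℚ.* outOf i m 1
  outOf-as-* i m k = /-as-* k (suc (toℕ i) ^ m) {{ℕ.m^n≢0 (suc (toℕ i)) m}}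

  outOf-mono : (i : Fin n) (m : ℕ) {a b : ℕ} → a ℕ.≤ b → outOf i m a ℚ.≤ outOf i m b
  outOf-mono i m = /-monoˡ-≤ (suc (toℕ i) ^ m) {{ℕ.m^n≢0 (suc (toℕ i)) m}}

lam-nonNegative : (i : Fin n) (h : History n m) → 0ℚ ℚ.≤ lam i h
lam-nonNegative {m = m} i h = if-nonNegative (does (ℓ h ≤? i)) (ℚ.nonNegative⁻¹ (weight ℚ.* chance))
  where
  if-nonNegative : ∀ b {q} → 0ℚ ℚ.≤ q → 0ℚ ℚ.≤ (if b then q else 0ℚ)
  if-nonNegative true  0≤q = 0≤q
  if-nonNegative false 0≤q = ℚ.≤-refl
  instance
    _ : NonZero (factorials h)
    _ = factorials≢0 h
    _ : NonZero (suc (toℕ i) ^ m)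
    _ = ℕ.m^n≢0 (suc (toℕ i)) m
  weight = (+ (m !)) / factorials h
  chance = (+ 1) / (suc (toℕ i) ^ m)
  instance
    _ : NonNegative (weight ℚ.* chance)
    _ = ℚ.nonNeg*nonNeg⇒nonNeg weight {{ℚ.normalize-nonNeg (m !) (factorials h)}}
                               chance {{ℚ.normalize-nonNeg 1 (suc (toℕ i) ^ m)}}

-- The multinomial coefficient is the number of tuples with history `h`, so `lam i h` is the
-- probability of `h` when the maximum is at `i`.
lam-orderings : (i : Fin n) (h : History n (suc m)) → ℓ h Fin.≤ i →
                lam i h ≡ fromℕ (#orderings i h) ℚ.* outOf i (suc m) 1
lam-orderings {m = m} i h ℓ≤i = begin
  lam i h                                        ≡⟨ cong (if_then weight ℚ.* chance else 0ℚ) (dec-true (ℓ h ≤? i) ℓ≤i) ⟩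
  weight ℚ.* chance
    ≡⟨ cong₂ ℚ._*_ (fromℕ-quotient {{factorials≢0 h}} (#orderings-factorials i h ℓ≤i)) (sym (outOf-def i (suc m) 1)) ⟩
  fromℕ (#orderings i h) ℚ.* outOf i (suc m) 1   ∎
  where
  open ≡-Reasoning
  weight = ((+ (suc m !)) / factorials h) {{factorials≢0 h}}
  chance = ((+ 1) / (suc (toℕ i) ^ suc m)) {{ℕ.m^n≢0 (suc (toℕ i)) (suc m)}}

-- Total probability: each history contributes its probability if the rule stops at `i` on it.
-- Grouping tuples by history with `count-historyOf` gives the number of winning tuples.
value-#wins : (τ : Rule n (suc m)) (i : Fin n) → value τ i ≡ outOf i (suc m) (#wins τ i)
value-#wins {m = m} τ i = begin
  value τ i                                                ≡⟨ ∑-cong (λ h h∈ → term h (∈-historiesUpTo⁻ h∈)) ⟩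
  ∑[ h ∈ historiesUpTo i ] (fromℕ (wins h) ℚ.* r)          ≡⟨ ∑-* (historiesUpTo i) (fromℕ ∘ wins) r ⟩
  ∑ (historiesUpTo i) (fromℕ ∘ wins) ℚ.* r                 ≡⟨ cong (ℚ._* r) (∑-fromℕ (historiesUpTo i) wins) ⟩
  fromℕ (sum (map wins (historiesUpTo i))) ℚ.* r
    ≡⟨ cong (λ k → fromℕ k ℚ.* r) (count-historyOf i (λ h → clamp τ h ≟ i)) ⟨
  fromℕ (#wins τ i) ℚ.* r                                  ≡⟨ outOf-as-* i (suc m) (#wins τ i) ⟨
  outOf i (suc m) (#wins τ i)                              ∎
  where
  open ≡-Reasoning
  r = outOf i (suc m) 1
  wins : History _ _ → ℕ
  wins h = #orderings i h * indicator (clamp τ h ≟ i)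
  term : ∀ h → ℓ h Fin.≤ i → lam i h ℚ.* assignment τ h i ≡ fromℕ (wins h) ℚ.* r
  term h ℓ≤i = begin
    lam i h ℚ.* b                 ≡⟨ cong (ℚ._* b) (lam-orderings i h ℓ≤i) ⟩
    (fromℕ N ℚ.* r) ℚ.* b         ≡⟨ ℚ.*-assoc (fromℕ N) r b ⟩
    fromℕ N ℚ.* (r ℚ.* b)         ≡⟨ cong (fromℕ N ℚ.*_) (ℚ.*-comm r b) ⟩
    fromℕ N ℚ.* (b ℚ.* r)         ≡⟨ ℚ.*-assoc (fromℕ N) b r ⟨
    (fromℕ N ℚ.* b) ℚ.* r         ≡⟨ cong (ℚ._* r) (fromℕ-* N (indicator (clamp τ h ≟ i))) ⟨
    fromℕ (wins h) ℚ.* r          ∎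
    where
    N = #orderings i h
    b = assignment τ h i

value-cong : (τ τ′ : Rule n m) → τ ≗ τ′ → ∀ i → value τ i ≡ value τ′ i
value-cong τ τ′ eq i = ∑-cong {xs = historiesUpTo i} λ h _ →
  cong (λ t → lam i h ℚ.* fromℕ (indicator ((if does (ℓ h ≤? t) then t else ℓ h) ≟ i))) (eq h)

opaque
  -- Outside this block only the two inequalities of a minimum over `i` are used, so the choice of
  -- minimizer is hidden.
  worst : Rule (suc n) m → ℚ
  worst τ = value τ (minimizer (value τ))

  worst≤value : (τ : Rule (suc n) m) → ∀ i → worst τ ℚ.≤ value τ i
  worst≤value τ = minimizer-≤ (value τ)

  ≤-worst : (τ : Rule (suc n) m) {q : ℚ} → (∀ i → q ℚ.≤ value τ i) → q ℚ.≤ worst τ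
  ≤-worst τ q≤ = q≤ (minimizer (value τ))

worst-mono : (τ τ′ : Rule (suc n) m) → (∀ i → value τ i ℚ.≤ value τ′ i) → worst τ ℚ.≤ worst τ′
worst-mono τ τ′ le = ≤-worst τ′ λ i → ℚ.≤-trans (worst≤value τ i) (le i)

worst-cong : (τ τ′ : Rule (suc n) m) → τ ≗ τ′ → worst τ ≡ worst τ′
-- The minimizers of the two rules are not compared; each worst case bounds the other.
worst-cong τ τ′ eq = ℚ.≤-antisym
  (worst-mono τ τ′ (λ i → ℚ.≤-reflexive (value-cong τ τ′ eq i)))
  (worst-mono τ′ τ (λ i → ℚ.≤-reflexive (sym (value-cong τ τ′ eq i))))

optimalRule : ∀ n m → ∃[ τ ] (∀ τ′ → worst {n} {m} τ′ ℚ.≤ worst τ)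
optimalRule n m = proj₁ best , λ τ′ → proj₂ best τ′ λ h h∉ → contradiction (∈-histories h) h∉
  where
  -- The starting function `ℓ` is arbitrary: the list contains all histories, so competitors need
  -- not agree with it anywhere.
  best = maximum-over-functions _≟ʰ_ worst (λ {τ} {τ′} → worst-cong τ τ′) (histories (suc n) m) ℓ

assignment-feasible : (τ : Rule (suc n) m) → Feasible (suc n) m (assignment τ) (worst τ)
assignment-feasible {n} τ = record
  { stopOnce = λ h → let ts = filter (ℓ h ≤?_) (allFin (suc n)) in begin
      ∑ ts (assignment τ h)                                  ≡⟨ ∑-fromℕ ts _ ⟩
      fromℕ (sum (map (λ t → indicator (clamp τ h ≟ t)) ts))
        -- `clamp τ h` is at least `ℓ h`, so it occurs in `ts`, exactly once.
        ≡⟨ cong fromℕ (sum-indicator-∈ (Unique.filter⁺ (ℓ h ≤?_) (Unique.allFin⁺ _))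
                                       (∈-filter⁺ (ℓ h ≤?_) (∈-allFin _) (ℓ≤clamp τ h))) ⟩
      fromℕ 1                                                ≡⟨ fromℕ-1 ⟩
      1ℚ                                                     ∎
  ; winning = worst≤value τ
  ; binary = λ h t _ → binary (clamp τ h ≟ t)
  }
  where
  open ≡-Reasoning
  binary : ∀ {P : Set} (d : Dec P) → fromℕ (indicator d) ≡ 0ℚ ⊎ fromℕ (indicator d) ≡ 1ℚ
  binary (yes _) = inj₂ fromℕ-1
  binary (no _)  = inj₁ fromℕ-0

module _ {x : History (suc n) m → Fin (suc n) → ℚ} {z : ℚ} (feasible : Feasible (suc n) m x z) where

  open Feasible feasible

  private
    Chosen : History (suc n) m → Fin (suc n) → Set
    Chosen h t = ℓ h Fin.≤ t × x h t ≡ 1ℚ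

    chosen? : ∀ h → Dec (∃[ t ] Chosen h t)
    chosen? h = Fin.any? λ t → (ℓ h ≤? t) ×-dec (x h t ℚ.≟ 1ℚ)

    -- The summed entries are non-negative by `binary`, so two distinct entries 1 would make the row
    -- sum at least 2.
    chosen-unique : ∀ h {t t′} → Chosen h t → Chosen h t′ → t ≡ t′
    chosen-unique h {t} {t′} (ℓ≤t , xt) (ℓ≤t′ , xt′) with t ≟ t′
    ... | yes t≡t′ = t≡t′
    ... | no  t≢t′ = contradiction
      (subst₂ ℚ._≤_ (cong₂ ℚ._+_ xt xt′) (stopOnce h) (∑-≥-two nonneg (∈ts ℓ≤t) (∈ts ℓ≤t′) t≢t′))
      λ { (ℚ.*≤* (ℤ.+≤+ (s≤s ()))) }
      where
      ∈ts : ∀ {s} → ℓ h Fin.≤ s → s ∈ filter (ℓ h ≤?_) (allFin (suc n))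
      ∈ts = ∈-filter⁺ (ℓ h ≤?_) (∈-allFin _)
      nonneg : ∀ s → s ∈ filter (ℓ h ≤?_) (allFin (suc n)) → 0ℚ ℚ.≤ x h s
      nonneg s s∈ with binary h s (proj₂ (∈-filter⁻ (ℓ h ≤?_) {xs = allFin (suc n)} s∈))
      ... | inj₁ eq = ℚ.≤-reflexive (sym eq)
      ... | inj₂ eq = subst (0ℚ ℚ.≤_) (trans fromℕ-1 (sym eq)) (0≤fromℕ 1)

  chosenRule : Rule (suc n) m
  chosenRule h with chosen? h
  ... | yes (t , _) = t
  -- Here no entry from `ℓ h` on is 1, so by `binary` all are 0 and `≤assignment` holds for any
  -- default.
  ... | no  _       = ℓ h

  private
    clamp-chosen : ∀ h t → Chosen h t → clamp chosenRule h ≡ t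
    clamp-chosen h t c = trans (clamp-id chosenRule h (subst (ℓ h Fin.≤_) (sym rule≡t) (proj₁ c))) rule≡t
      where
      rule≡t : chosenRule h ≡ t
      rule≡t with chosen? h
      ... | yes (_ , c′) = chosen-unique h c′ c
      ... | no  ¬c       = contradiction (t , c) ¬c

    ≤assignment : ∀ h i → ℓ h Fin.≤ i → x h i ℚ.≤ assignment chosenRule h i
    ≤assignment h i ℓ≤i with binary h i ℓ≤i
    ... | inj₁ eq = ℚ.≤-trans (ℚ.≤-reflexive eq) (0≤fromℕ (indicator (clamp chosenRule h ≟ i)))
    ... | inj₂ eq = ℚ.≤-reflexive (trans (trans eq (sym fromℕ-1))
                      (cong fromℕ (sym (indicator-yes (clamp chosenRule h ≟ i) (clamp-chosen h i (ℓ≤i , eq))))))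

  -- Passing from `x` to `assignment chosenRule` lowers no variable of the program, and `lam` is
  -- non-negative, so no left-hand side in `winning` decreases.
  feasible-≤-worst : z ℚ.≤ worst chosenRule
  feasible-≤-worst = ≤-worst chosenRule λ i → ℚ.≤-trans (winning i) (∑-mono {xs = historiesUpTo i} λ h h∈ →
    ℚ.*-monoˡ-≤-nonNeg (lam i h) {{nonNegative (lam-nonNegative i h)}} (≤assignment h i (∈-historiesUpTo⁻ h∈)))

-- Policies

stopsAt-unique : (π : Policy n) (obs : Vec (ℕ × ℕ) n) → ∀ {s t} → StopsAt π obs s → StopsAt π obs t → s ≡ t
stopsAt-unique π obs {s} {t} (stop-s , before-s) (stop-t , before-t) with Fin.<-cmp s t
... | tri< s<t _ _ = contradiction stop-s (before-t s s<t)
... | tri≈ _ s≡t _ = s≡t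
... | tri> _ _ t<s = contradiction stop-t (before-s t t<s)

decision-cong : (π : Policy n) {obs obs′ : Vec (ℕ × ℕ) n} {t : Fin n} →
                (∀ s → s Fin.≤ t → lookup obs s ≡ lookup obs′ s) → decision π obs t ≡ decision π obs′ t
decision-cong π {obs} {obs′} {t} eq = cong (π t) (lookup-ext λ s → begin
  lookup (truncate (Fin.toℕ<n t) obs) s    ≡⟨ lookup-truncate (Fin.toℕ<n t) obs s ⟩
  lookup obs (inject≤ s (Fin.toℕ<n t))     ≡⟨ eq _ inject≤t ⟩
  lookup obs′ (inject≤ s (Fin.toℕ<n t))    ≡⟨ lookup-truncate (Fin.toℕ<n t) obs′ s ⟨
  lookup (truncate (Fin.toℕ<n t) obs′) s   ∎)
  where
  open ≡-Reasoning
  inject≤t : ∀ {s} → inject≤ s (Fin.toℕ<n t) Fin.≤ t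
  inject≤t {s} = subst (ℕ._≤ toℕ t) (sym (Fin.toℕ-inject≤ s _)) (ℕ.≤-pred (Fin.toℕ<n s))

-- The decisions up to `t` involve only the observations up to `t`, so sequences with a common
-- prefix through `t` cannot be told apart by then.
stopsAt-cong : (π : Policy n) {obs obs′ : Vec (ℕ × ℕ) n} {t : Fin n} →
               (∀ s → s Fin.≤ t → lookup obs s ≡ lookup obs′ s) → StopsAt π obs t → StopsAt π obs′ t
stopsAt-cong π eq (stop , before) =
  subst T (decision-cong π eq) stop ,
  λ s s<t → before s s<t ∘ subst T (sym (decision-cong π λ r r≤s → eq r (ℕ.≤-trans r≤s (ℕ.<⇒≤ s<t))))

successProbability-outOf : ∀ m (π : Policy n) (I : Instance n) → let open Instance I in
  successProbability m π I ≡
  outOf i⋆ m (length (filter (λ S → stopsAt? π (observations v S) i⋆) (vectors (upTo i⋆) m)))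
successProbability-outOf m π I = sym (outOf-def (Instance.i⋆ I) m _)

lookup-observations : (v : Vec ℕ n) (S : Vec (Fin n) m) → ∀ t →
                      lookup (observations v S) t ≡ (lookup v t , occurrences S t)
lookup-observations v S = lookup∘tabulate _

-- At time `t` the final history may still be unknown. The policy looks for a history `h` that
-- matches the counts so far and has stopping time `t`; as `ℓ h` is at most `t`, such a match
-- already determines the history.
policyOf : Rule n m → Policy n
policyOf {n} {m} τ t w = ⌊ Any.any? matches? (histories n m) ⌋
  where
  expected : History n m → Fin (suc (toℕ t)) → ℕ
  expected h s = signals (counts h) (inject≤ s (Fin.toℕ<n t))
  matches? : ∀ h → Dec (clamp τ h ≡ t × (∀ s → proj₂ (lookup w s) ≡ expected h s))
  matches? h = (clamp τ h ≟ t) ×-dec Fin.all? λ s → proj₂ (lookup w s) ℕ.≟ expected h s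

module _ (τ : Rule n (suc m)) (v : Vec ℕ n) (S : Vec (Fin n) (suc m)) where

  private
    obs = observations v S

    observed : ∀ {t} s → proj₂ (lookup (truncate (Fin.toℕ<n t) obs) s) ≡ occurrences S (inject≤ s (Fin.toℕ<n t))
    observed {t} s = cong proj₂ (trans (lookup-truncate (Fin.toℕ<n t) obs s) (lookup-observations v S _))

  policyOf-decision⁺ : ∀ {t} → clamp τ (historyOf S) ≡ t → T (decision (policyOf τ) obs t)
  policyOf-decision⁺ eq = fromWitness (lose (∈-histories (historyOf S))
    (eq , λ s → trans (observed s) (historyOf-counts S _)))

  -- The match extends through `t`, which is `clamp τ h` and hence at least `ℓ h`. By
  -- `historyOf-prefix` the actual history is `h`, so the policy never stops on a wrong guess.
  policyOf-decision⁻ : ∀ {t} → T (decision (policyOf τ) obs t) → clamp τ (historyOf S) ≡ t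
  policyOf-decision⁻ {t} stop with h , _ , refl , match ← find (toWitness stop) =
    cong (clamp τ) (historyOf-prefix h S λ s s≤ℓ → prefix s (ℕ.≤-trans s≤ℓ (ℓ≤clamp τ h)))
    where
    prefix : ∀ s → s Fin.≤ t → occurrences S s ≡ signals (counts h) s
    prefix s s≤t = subst (λ r → occurrences S r ≡ signals (counts h) r) inject≡
                     (trans (sym (observed (fromℕ< (s≤s s≤t)))) (match (fromℕ< (s≤s s≤t))))
      where
      inject≡ : inject≤ (fromℕ< (s≤s s≤t)) (Fin.toℕ<n t) ≡ s
      inject≡ = Fin.toℕ-injective (trans (Fin.toℕ-inject≤ _ _) (Fin.toℕ-fromℕ< _))

  -- The decision to stop is taken at one time only, so no earlier one can intervene.
  policyOf-stopsAt⁺ : ∀ {t} → clamp τ (historyOf S) ≡ t → StopsAt (policyOf τ) obs t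
  policyOf-stopsAt⁺ eq = policyOf-decision⁺ eq ,
    λ s s<t stop → Fin.<⇒≢ s<t (trans (sym (policyOf-decision⁻ stop)) eq)

policyOf-success : (τ : Rule n (suc m)) (I : Instance n) →
                   successProbability (suc m) (policyOf τ) I ≡ value τ (Instance.i⋆ I)
policyOf-success {m = m} τ I = begin
  successProbability (suc m) (policyOf τ) I  ≡⟨ successProbability-outOf (suc m) (policyOf τ) I ⟩
  outOf i⋆ (suc m) _
    ≡⟨ cong (outOf i⋆ (suc m) ∘ length) (filter-≐ stops? wins?
         ((λ {S} → policyOf-decision⁻ τ v S ∘ proj₁) , (λ {S} → policyOf-stopsAt⁺ τ v S))
         (vectors (upTo i⋆) (suc m))) ⟩
  outOf i⋆ (suc m) (#wins τ i⋆)              ≡⟨ value-#wins τ i⋆ ⟨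
  value τ i⋆                                 ∎
  where
  open ≡-Reasoning
  open Instance I
  stops? = λ S → stopsAt? (policyOf τ) (observations v S) i⋆
  wins?  = λ S → clamp τ (historyOf S) ≟ i⋆

-- The adversary's instances.

adversary : Fin n → Instance n
adversary {n} i = record { v = tabulate height ; i⋆ = i ; uniqueMax = unique }
  where
  height : Fin n → ℕ
  -- Heights start at 1, so the maximum exceeds the zeros after `i` even when `i` is the first time.
  height t = if does (t ≤? i) then suc (toℕ t) else 0
  height-i : height i ≡ suc (toℕ i)
  height-i = cong (if_then suc (toℕ i) else 0) (dec-true (i ≤? i) ℕ.≤-refl)
  lower : ∀ j → j ≢ i → height j ℕ.< suc (toℕ i)
  lower j j≢i with j ≤? i
  ... | yes j≤i = subst (ℕ._< _) (sym (cong (if_then suc (toℕ j) else 0) (dec-true (j ≤? i) j≤i)))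
                    (s≤s (Fin.≤∧≢⇒< j≤i j≢i))
  ... | no  j≰i = subst (ℕ._< _) (sym (cong (if_then suc (toℕ j) else 0) (dec-false (j ≤? i) j≰i))) (s≤s z≤n)
  unique : ∀ j → j ≢ i → lookup (tabulate height) j ℕ.< lookup (tabulate height) i
  unique j j≢i = subst₂ ℕ._<_ (sym (lookup∘tabulate height j))
                              (sym (trans (lookup∘tabulate height i) height-i)) (lower j j≢i)

lookup-adversary : (i : Fin n) → ∀ t → t Fin.≤ i → lookup (Instance.v (adversary i)) t ≡ suc (toℕ t)
lookup-adversary i t t≤i = trans (lookup∘tabulate _ t)
  (cong (if_then suc (toℕ t) else 0) (dec-true (t ≤? i) t≤i))

-- Through time `i` this agrees with what `adversary i` shows on signals with history `h`, so one
-- run on it serves every `i`.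
increasing : History n m → Vec (ℕ × ℕ) n
increasing h = tabulate λ t → suc (toℕ t) , signals (counts h) t

ruleOf : Policy n → Rule n m
ruleOf π h with Fin.any? (stopsAt? π (increasing h))
... | yes (t , _) = t
-- A policy that never stops here wins on `h` against no `adversary i`, so any default does.
... | no  _       = ℓ h

ruleOf-stops : (π : Policy n) (h : History n m) → ∀ {t} → StopsAt π (increasing h) t → ruleOf π h ≡ t
ruleOf-stops π h {t} stops with Fin.any? (stopsAt? π (increasing h))
... | yes (_ , stops′) = stopsAt-unique π (increasing h) stops′ stops
... | no  ¬stops       = contradiction (t , stops) ¬stops

-- Every tuple won by `π` is won by the rule. The converse can fail, as the default and `clamp` may
-- add wins; hence an inequality.
adversary-success : (π : Policy n) (i : Fin n) →
                    successProbability (suc m) π (adversary i) ℚ.≤ value (ruleOf π) i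
adversary-success {m = m} π i = subst₂ ℚ._≤_
  (sym (successProbability-outOf (suc m) π (adversary i))) (sym (value-#wins (ruleOf π) i))
  (outOf-mono i (suc m) (length-filter-mono stops? wins? (vectors (upTo i) (suc m)) win))
  where
  open Instance (adversary i) using (v)
  stops? = λ S → stopsAt? π (observations v S) i
  wins?  = λ S → clamp (ruleOf π) (historyOf S) ≟ i
  win : ∀ S → S ∈ vectors (upTo i) (suc m) → StopsAt π (observations v S) i →
        clamp (ruleOf π) (historyOf S) ≡ i
  win S S∈ stops = trans
    -- All signals lie up to `i`, so the last one does too and `clamp` leaves the stopping time `i`
    -- alone.
    (clamp-id (ruleOf π) (historyOf S) (subst (ℓ (historyOf S) Fin.≤_) (sym rule≡i) (ℓ-historyOf S S∈))) rule≡i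
    where
    same : ∀ t → t Fin.≤ i → lookup (observations v S) t ≡ lookup (increasing (historyOf S)) t
    same t t≤i = trans (lookup-observations v S t)
      (trans (cong₂ _,_ (lookup-adversary i t t≤i) (historyOf-counts S t)) (sym (lookup∘tabulate _ t)))
    rule≡i : ruleOf π (historyOf S) ≡ i
    rule≡i = ruleOf-stops π (historyOf S) (stopsAt-cong π same stops)

-- Success depends on the instance only through `i⋆`, and `adversary i` shows that each `i` occurs,
-- so a lower bound over all instances bounds every `value τ i`.
policyOf-worst : (τ : Rule (suc n) (suc m)) → IsWorstCase (suc m) (policyOf τ) (worst τ)
policyOf-worst τ =
  (λ { q (I , refl) → subst (worst τ ℚ.≤_) (sym (policyOf-success τ I)) (worst≤value τ (Instance.i⋆ I)) }) ,
  (λ u u≤ → ≤-worst τ λ i → subst (u ℚ.≤_) (policyOf-success τ (adversary i)) (u≤ _ (adversary i , refl)))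

worst-ruleOf : (π : Policy (suc n)) {w : ℚ} → IsWorstCase (suc m) π w → w ℚ.≤ worst (ruleOf {m = suc m} π)
worst-ruleOf π (w≤ , _) = ≤-worst (ruleOf π) λ i → ℚ.≤-trans (w≤ _ (adversary i , refl)) (adversary-success π i)

theorem9 : (n m : ℕ) → 1 ≤ n → 1 ≤ m → ∃[ z ] (IsILPValue n m z × IsOPT n m z)
theorem9 (suc n) (suc m) _ _ =
  worst best ,
  ((assignment best , assignment-feasible best) ,
   λ q (x , feasible) → ℚ.≤-trans (feasible-≤-worst feasible) (optimal (chosenRule feasible))) ,
  (λ w (π , isWorst) → ℚ.≤-trans (worst-ruleOf π isWorst) (optimal (ruleOf π))) ,
  -- The supremum is attained, so an upper bound `u` is at least the worst case of `policyOf best`.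
  (λ u bound → bound (worst best) (policyOf best , policyOf-worst best))
  where
  best    = proj₁ (optimalRule n (suc m))
  optimal = proj₂ (optimalRule n (suc m))
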